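{- Let $R$ be a commutative ring with unity and let $m\ge1$ be an integer. Let $\{g_n(x)\}_{n\ge0}\subset R[x]$ be given by $$g_n(x)=\sum_{c=0}^{w_m(n)}\mu_1(n,c)\,x^{n-mc},\qquad \mu_1(n,0)\in R^\times\ \text{ for all } n\in\mathbb N,$$ with $\mu_1(n,c)\in R$. If two families $\{\mu_3^{(1)}(n,k)\}$ and $\{\mu_3^{(2)}(n,k)\}$ of elements of $R$ (indexed by $n\in\mathbb N$, $0\le k\le w_m(n)$) satisfy, for all $n\in\mathbb N$, $$x^n=\sum_{k=0}^{w_m(n)}\mu_3^{(1)}(n,k)\,g_{n-mk}(x)=\sum_{k=0}^{w_m(n)}\mu_3^{(2)}(n,k)\,g_{n-mk}(x),$$ then $\mu_3^{(1)}(n,k)=\mu_3^{(2)}(n,k)$ for all $n\in\mathbb N$ and $0\le k\le w_m(n)$. In particular, the inversion coefficients are unique whenever they exist.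
   Context: $\mathbb N=\{0,1,2,\dots\}$, $w_m(n)=\lfloor n/m\rfloor$, and $R^\times$ is the group of units of $R$. -}

module Defs where

open import Algebra.Bundles using (CommutativeRing; CommutativeMonoid)
import Algebra.Definitions as AlgDefs
open import Data.Fin.Base using (Fin; toℕ)
open import Data.List.Base using (List; []; _∷_; map)
open import Data.Nat.Base as ℕ using (ℕ; zero; suc; NonZero)
import Data.Nat.DivMod as ℕ
open import Data.Product.Base using (_,_)
open import Level using (_⊔_)
open import Relation.Binary.Structures using (IsEquivalence)
import Algebra.Properties.CommutativeMonoid.Sum as MonoidSum

w : (m : ℕ) .{{_ : NonZero m}} → ℕ → ℕ
w m n = n ℕ./ m

module Polynomials {c ℓ} (R : CommutativeRing c ℓ) where

  open CommutativeRing R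

  IsUnit : Carrier → Set (c ⊔ ℓ)
  IsUnit = AlgDefs.Invertible _≈_ 1# _*_

  -- a₀ ∷ a₁ ∷ … ∷ a_d ∷ [] stands for a₀ + a₁x + … + a_d x^d.  Trailing
  -- zeros are allowed, so equality in R[x] is _≋_ below, not _≡_.
  Poly : Set c
  Poly = List Carrier

  coeff : Poly → ℕ → Carrier
  coeff []      _       = 0#
  coeff (a ∷ p) zero    = a
  coeff (a ∷ p) (suc i) = coeff p i

  infix 4 _≋_

  record _≋_ (p q : Poly) : Set ℓ where
    constructor mk≋
    field
      coeff-≈ : ∀ i → coeff p i ≈ coeff q i

  open _≋_ public

  infixl 6 _+ₚ_
  infixr 7 _·_

  _+ₚ_ : Poly → Poly → Poly
  []      +ₚ q       = q
  (a ∷ p) +ₚ []      = a ∷ p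
  (a ∷ p) +ₚ (b ∷ q) = (a + b) ∷ (p +ₚ q)

  _·_ : Carrier → Poly → Poly
  a · p = map (a *_) p

  -- Multiplication by x prepends a zero coefficient.
  x^_ : ℕ → Poly
  x^ zero  = 1# ∷ []
  x^ suc n = 0# ∷ x^ n

  coeff-+ : ∀ p q i → coeff (p +ₚ q) i ≈ coeff p i + coeff q i
  coeff-+ []      q       i       = sym (+-identityˡ (coeff q i))
  coeff-+ (a ∷ p) []      i       = sym (+-identityʳ (coeff (a ∷ p) i))
  coeff-+ (a ∷ p) (b ∷ q) zero    = refl
  coeff-+ (a ∷ p) (b ∷ q) (suc i) = coeff-+ p q i

  ≋-isEquivalence : IsEquivalence _≋_
  ≋-isEquivalence = record
    { refl  = mk≋ λ i → refl
    ; sym   = λ p≋q → mk≋ λ i → sym (coeff-≈ p≋q i)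
    ; trans = λ p≋q q≋r → mk≋ λ i → trans (coeff-≈ p≋q i) (coeff-≈ q≋r i)
    }

  +ₚ-commutativeMonoid : CommutativeMonoid c ℓ
  +ₚ-commutativeMonoid = record
    { Carrier = Poly
    ; _≈_     = _≋_
    ; _∙_     = _+ₚ_
    ; ε       = []
    ; isCommutativeMonoid = record
      { isMonoid = record
        { isSemigroup = record
          { isMagma = record
            { isEquivalence = ≋-isEquivalence
            ; ∙-cong = λ {p} {q} {r} {s} p≋q r≋s → mk≋ λ i →
                trans (coeff-+ p r i)
                (trans (+-cong (coeff-≈ p≋q i) (coeff-≈ r≋s i))
                (sym (coeff-+ q s i)))
            }
          ; assoc = λ p q r → mk≋ λ i →
              trans (coeff-+ (p +ₚ q) r i)
              (trans (+-congʳ (coeff-+ p q i))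
              (trans (+-assoc (coeff p i) (coeff q i) (coeff r i))
              (trans (+-congˡ (sym (coeff-+ q r i)))
              (sym (coeff-+ p (q +ₚ r) i)))))
          }
        ; identity = (λ p → mk≋ λ i → refl)
                   , (λ p → mk≋ λ i →
                       trans (coeff-+ p [] i) (+-identityʳ (coeff p i)))
        }
      ; comm = λ p q → mk≋ λ i →
          trans (coeff-+ p q i)
          (trans (+-comm (coeff p i) (coeff q i))
          (sym (coeff-+ q p i)))
      }
    }

  open MonoidSum +ₚ-commutativeMonoid public using () renaming (sum to sumₚ)

  module _ (m : ℕ) .{{_ : NonZero m}} where

    -- The second index ranges over 0, …, w_m(n) inclusive.
    Coefficients : Set c
    Coefficients = (n : ℕ) → Fin (suc (w m n)) → Carrier

    _≈ᶜ_ : Coefficients → Coefficients → Set ℓ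
    μ ≈ᶜ ν = ∀ n k → μ n k ≈ ν n k

    -- The truncated subtractions below are exact, since k ≤ ⌊n/m⌋ gives
    -- m k ≤ n.
    IsExpansion : Coefficients → (ℕ → Poly) → Set ℓ
    IsExpansion μ g = ∀ n →
      g n ≋ sumₚ (λ k → μ n k · x^ (n ℕ.∸ m ℕ.* toℕ k))

    IsInversion : Coefficients → (ℕ → Poly) → Set ℓ
    IsInversion μ g = ∀ n →
      x^ n ≋ sumₚ (λ k → μ n k · g (n ℕ.∸ m ℕ.* toℕ k))

{-# OPTIONS --safe #-}
-- Every g_n has degree n with unit leading coefficient, so in
-- Σ_k μ(n,k) g_{n−mk} the degrees n − mk strictly decrease in k.  Comparing
-- the coefficients of x^n of two such sums and cancelling the unit
-- determines μ(n,0); cancelling the first summand and repeating determines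
-- the remaining coefficients.
module Submission where

open import Defs
open import Algebra.Bundles using (CommutativeRing)
import Algebra.Properties.Ring as RingProperties
open import Data.Fin.Base as Fin using (Fin; zero; suc; toℕ)
open import Data.Fin.Properties using (toℕ≤pred[n])
open import Data.List.Base using ([]; _∷_)
open import Data.Nat.Base as ℕ using (ℕ; zero; suc; NonZero; z<s; s<s)
open import Data.Nat.DivMod using (m/n*n≤m)
import Data.Nat.Properties as ℕ
open import Data.Product using (_×_; _,_; ∃; ∃!)
open import Data.Vec.Functional using (Vector)
open import Function.Base using (_∘_)
open import Relation.Binary.Core using (_Preserves_⟶_)
import Relation.Binary.PropositionalEquality as ≡
import Relation.Binary.Reasoning.Setoid as SetoidReasoning

m*k≤n : ∀ m .{{_ : NonZero m}} n (k : Fin (suc (w m n))) → m ℕ.* toℕ k ℕ.≤ n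
m*k≤n m n k = begin
  m ℕ.* toℕ k    ≡⟨ ℕ.*-comm m (toℕ k) ⟩
  toℕ k ℕ.* m    ≤⟨ ℕ.*-monoˡ-≤ m (toℕ≤pred[n] k) ⟩
  w m n ℕ.* m    ≤⟨ m/n*n≤m n m ⟩
  n              ∎
  where open ℕ.≤-Reasoning

exponent : ∀ m .{{_ : NonZero m}} n → Fin (suc (w m n)) → ℕ
exponent m n k = n ℕ.∸ m ℕ.* toℕ k

exponent-decreasing : ∀ m .{{_ : NonZero m}} n →
  exponent m n Preserves Fin._<_ ⟶ ℕ._>_
exponent-decreasing m n {k} {l} k<l = ℕ.∸-monoʳ-< (ℕ.*-monoʳ-< m k<l) (m*k≤n m n l)

module LeadingTerms {c ℓ} (R : CommutativeRing c ℓ) where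

  open CommutativeRing R hiding (zero)
  open Polynomials R
  open RingProperties ring using (+-cancelˡ)
  open SetoidReasoning setoid

  unit-cancelʳ : ∀ {u} → IsUnit u → ∀ a b → a * u ≈ b * u → a ≈ b
  unit-cancelʳ {u} (v , _ , uv≈1) a b au≈bu = begin
    a            ≈⟨ *-identityʳ a ⟨
    a * 1#       ≈⟨ *-congˡ uv≈1 ⟨
    a * (u * v)  ≈⟨ *-assoc a u v ⟨
    a * u * v    ≈⟨ *-congʳ au≈bu ⟩
    b * u * v    ≈⟨ *-assoc b u v ⟩
    b * (u * v)  ≈⟨ *-congˡ uv≈1 ⟩
    b * 1#       ≈⟨ *-identityʳ b ⟩
    b            ∎

  IsUnit-resp-≈ : ∀ {u v} → u ≈ v → IsUnit u → IsUnit v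
  IsUnit-resp-≈ u≈v (u⁻¹ , u⁻¹u≈1 , uu⁻¹≈1) =
    u⁻¹ , trans (*-congˡ (sym u≈v)) u⁻¹u≈1 , trans (*-congʳ (sym u≈v)) uu⁻¹≈1

  coeff-· : ∀ a p i → coeff (a · p) i ≈ a * coeff p i
  coeff-· a []      i       = sym (zeroʳ a)
  coeff-· a (b ∷ p) zero    = refl
  coeff-· a (b ∷ p) (suc i) = coeff-· a p i

  coeff-·-≈0 : ∀ a p i → coeff p i ≈ 0# → coeff (a · p) i ≈ 0#
  coeff-·-≈0 a p i pᵢ≈0 = trans (coeff-· a p i) (trans (*-congˡ pᵢ≈0) (zeroʳ a))

  coeff-sum-≈0 : ∀ {n} (t : Vector Poly n) i →
    (∀ k → coeff (t k) i ≈ 0#) → coeff (sumₚ t) i ≈ 0#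
  coeff-sum-≈0 {zero}  t i tᵢ≈0 = refl
  coeff-sum-≈0 {suc n} t i tᵢ≈0 = begin
    coeff (sumₚ t) i                             ≈⟨ coeff-+ (t zero) (sumₚ (t ∘ suc)) i ⟩
    coeff (t zero) i + coeff (sumₚ (t ∘ suc)) i  ≈⟨ +-cong (tᵢ≈0 zero) (coeff-sum-≈0 (t ∘ suc) i (tᵢ≈0 ∘ suc)) ⟩
    0# + 0#                                      ≈⟨ +-identityʳ 0# ⟩
    0#                                           ∎

  -- Phrased through coefficients because trailing zeros make the length of a list meaningless for
  -- the degree.
  Degree≤ : ℕ → Poly → Set ℓ
  Degree≤ d p = ∀ {i} → d ℕ.< i → coeff p i ≈ 0#

  x^-degree : ∀ n → Degree≤ n (x^ n)
  x^-degree zero    z<s       = refl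
  x^-degree (suc n) (s<s n<i) = x^-degree n n<i

  x^-leading : ∀ n → coeff (x^ n) n ≈ 1#
  x^-leading zero    = refl
  x^-leading (suc n) = x^-leading n

  -- Each later `p (suc k)` has its degree bound below `d zero`, so only the first summand reaches
  -- this coefficient. Applied both to the monomials in `g n` and to the `g` in an inversion.
  leading-coeff-sum : ∀ {n} (d : Fin (suc n) → ℕ) → d Preserves Fin._<_ ⟶ ℕ._>_ →
    (p : Vector Poly (suc n)) → (∀ k → Degree≤ (d k) (p k)) →
    (a : Vector Carrier (suc n)) →
    coeff (sumₚ (λ k → a k · p k)) (d zero) ≈ a zero * coeff (p zero) (d zero)
  leading-coeff-sum {n} d d-decreasing p p-degree a = begin
    coeff (sumₚ t) d₀                       ≈⟨ coeff-+ (t zero) (sumₚ (t ∘ suc)) d₀ ⟩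
    coeff (t zero) d₀ + coeff (sumₚ (t ∘ suc)) d₀
      ≈⟨ +-cong (coeff-· (a zero) (p zero) d₀) (coeff-sum-≈0 (t ∘ suc) d₀ tail≈0) ⟩
    a zero * coeff (p zero) d₀ + 0#         ≈⟨ +-identityʳ _ ⟩
    a zero * coeff (p zero) d₀              ∎
    where
    d₀ : ℕ
    d₀ = d zero

    t : Vector Poly (suc n)
    t k = a k · p k

    tail≈0 : ∀ k → coeff (t (suc k)) d₀ ≈ 0#
    tail≈0 k = coeff-·-≈0 (a (suc k)) (p (suc k)) d₀
      (p-degree (suc k) (d-decreasing z<s))

  ·-congʳ : ∀ {a b} p → a ≈ b → a · p ≋ b · p
  ·-congʳ {a} {b} p a≈b = mk≋ λ i →
    trans (coeff-· a p i) (trans (*-congʳ a≈b) (sym (coeff-· b p i)))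

  -- Two cancelled terms are allowed because the first summands agree only up to `_≋_`.
  +ₚ-cancelˡ : ∀ {p q r s} → p ≋ q → p +ₚ r ≋ q +ₚ s → r ≋ s
  +ₚ-cancelˡ {p} {q} {r} {s} p≋q p+r≋q+s = mk≋ λ i → +-cancelˡ (coeff p i) _ _ (begin
    coeff p i + coeff r i  ≈⟨ coeff-+ p r i ⟨
    coeff (p +ₚ r) i       ≈⟨ coeff-≈ p+r≋q+s i ⟩
    coeff (q +ₚ s) i       ≈⟨ coeff-+ q s i ⟩
    coeff q i + coeff s i  ≈⟨ +-congʳ (coeff-≈ p≋q i) ⟨
    coeff p i + coeff s i  ∎)

  combination-injective : ∀ {n} (d : Fin n → ℕ) → d Preserves Fin._<_ ⟶ ℕ._>_ →
    (p : Vector Poly n) → (∀ k → Degree≤ (d k) (p k)) →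
    (∀ k → IsUnit (coeff (p k) (d k))) → (a b : Vector Carrier n) →
    sumₚ (λ k → a k · p k) ≋ sumₚ (λ k → b k · p k) → ∀ k → a k ≈ b k
  -- The empty sum needs no clause, since `Fin zero` offers no `k`.
  combination-injective {suc n} d d-decreasing p p-degree p-unit a b eq = λ where
      zero    → a₀≈b₀
      (suc k) → combination-injective (d ∘ suc) (d-decreasing ∘ s<s) (p ∘ suc)
        (p-degree ∘ suc) (p-unit ∘ suc) (a ∘ suc) (b ∘ suc)
        -- `sumₚ` unfolds definitionally to its first summand plus the rest, so `eq` already has the
        -- shape to be cancelled.
        (+ₚ-cancelˡ {a zero · p zero} {b zero · p zero} (·-congʳ (p zero) a₀≈b₀) eq) k
    where
    a₀≈b₀ : a zero ≈ b zero
    a₀≈b₀ = unit-cancelʳ (p-unit zero) (a zero) (b zero) (begin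
      a zero * coeff (p zero) (d zero)        ≈⟨ leading-coeff-sum d d-decreasing p p-degree a ⟨
      coeff (sumₚ (λ k → a k · p k)) (d zero) ≈⟨ coeff-≈ eq (d zero) ⟩
      coeff (sumₚ (λ k → b k · p k)) (d zero) ≈⟨ leading-coeff-sum d d-decreasing p p-degree b ⟩
      b zero * coeff (p zero) (d zero)        ∎)

  module _ (m : ℕ) .{{_ : NonZero m}} {g : ℕ → Poly} {μ : Coefficients m}
           (expansion : IsExpansion m μ g) where

    expansion-degree : ∀ n → Degree≤ n (g n)
    expansion-degree n {i} n<i = trans (coeff-≈ (expansion n) i)
      (coeff-sum-≈0 (λ k → μ n k · x^ (exponent m n k)) i
        λ k → coeff-·-≈0 (μ n k) (x^ (exponent m n k)) i
          (x^-degree (exponent m n k) (ℕ.≤-<-trans (ℕ.m∸n≤m n (m ℕ.* toℕ k)) n<i)))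

    expansion-leading : ∀ n → coeff (g n) n ≈ μ n zero
    expansion-leading n = begin
      -- `e zero` is `n ∸ m * 0`, which does not reduce to `n` for a variable `m`, hence the
      -- rewriting of the index.
      coeff (g n) n                              ≡⟨ ≡.cong (coeff (g n)) e₀≡n ⟨
      coeff (g n) (e zero)                       ≈⟨ coeff-≈ (expansion n) (e zero) ⟩
      coeff (sumₚ (λ k → μ n k · x^ e k)) (e zero)
        ≈⟨ leading-coeff-sum e (exponent-decreasing m n) (λ k → x^ e k) (λ k → x^-degree (e k)) (μ n) ⟩
      μ n zero * coeff (x^ e zero) (e zero)      ≈⟨ *-congˡ (x^-leading (e zero)) ⟩
      μ n zero * 1#                              ≈⟨ *-identityʳ (μ n zero) ⟩
      μ n zero                                   ∎
      where
      e : Fin (suc (w m n)) → ℕ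
      e = exponent m n

      e₀≡n : e zero ≡.≡ n
      e₀≡n = ≡.cong (n ℕ.∸_) (ℕ.*-zeroʳ m)

    inversion-unique : (∀ n → IsUnit (μ n zero)) → (ν ν′ : Coefficients m) →
      IsInversion m ν g → IsInversion m ν′ g → ∀ n k → ν n k ≈ ν′ n k
    inversion-unique unit ν ν′ inv inv′ n =
      combination-injective (exponent m n) (exponent-decreasing m n) (g ∘ exponent m n)
        (λ k → expansion-degree (exponent m n k))
        -- The unit hypothesis is needed at every index `exponent m n k`, not just at `n`.
        (λ k → IsUnit-resp-≈ (sym (expansion-leading (exponent m n k))) (unit (exponent m n k)))
        (ν n) (ν′ n)
        -- Both combinations equal `x^ n`, which links them.
        (mk≋ λ i → trans (sym (coeff-≈ (inv n) i)) (coeff-≈ (inv′ n) i))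

theorem2p6 : ∀ {c ℓ} (R : CommutativeRing c ℓ) (m : ℕ) .{{_ : NonZero m}} →
    let open CommutativeRing R using (_≈_)
        open Polynomials R
    in
    (g : ℕ → Poly) (μ₁ : Coefficients m) →
    IsExpansion m μ₁ g →
    (∀ n → IsUnit (μ₁ n zero)) →
    ((μ₃ μ₃′ : Coefficients m) →
      IsInversion m μ₃ g → IsInversion m μ₃′ g →
      ∀ n k → μ₃ n k ≈ μ₃′ n k)
    × (∃ (λ μ₃ → IsInversion m μ₃ g) →
       ∃! (_≈ᶜ_ m) (λ μ₃ → IsInversion m μ₃ g))
theorem2p6 R m g μ₁ expansion unit =
    unique
  -- The given inversion is itself the witness for `∃!`.
  , λ (μ₃ , inv) → μ₃ , inv , λ {ν} inv′ → unique μ₃ ν inv inv′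
  where
  unique = LeadingTerms.inversion-unique R m {g} {μ₁} expansion unit
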